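{- For every possibilistic Kripke structure $M$, the function $Po=Po^M:2^{Paths(M)}\to[0,1]$ is a possibility measure on $\Omega=2^{Paths(M)}$. In general, however, the following condition does not hold: if $A_1\supseteq A_2\supseteq\cdots$ is a decreasing chain in $\Omega$, then $Po(\bigcap_{i}A_i)=\bigwedge_{i}Po(A_i)$. (That is, there exist a possibilistic Kripke structure $M$ and a decreasing chain $A_1\supseteq A_2\supseteq\cdots$ of subsets of $Paths(M)$ with $Po(\bigcap_i A_i)\ne\bigwedge_i Po(A_i)$.)
   Context: For subsets or families in $[0,1]$, $\vee$ denotes supremum and $\wedge$ infimum (with $\bigvee\emptyset=0$). A possibilistic Kripke structure is a tuple $M=(S,P,I,AP,L)$ where $S$ is a countable nonempty set of states; $P:S\times S\to[0,1]$ satisfies $\bigvee_{s'\in S}P(s,s')=1$ for all $s\in S$; $I:S\to[0,1]$ satisfies $\bigvee_{s\in S}I(s)=1$; $AP$ is a set of atomic propositions; and $L:S\to 2^{AP}$ is a labeling function. A path of $M$ is an infinite sequence $\pi=s_0s_1s_2\cdots\in S^\omega$ with $P(s_i,s_{i+1})>0$ for all $i\ge 0$; $Paths(M)$ is the set of all paths. Define $Po^M(\pi)=I(s_0)\wedge\bigwedge_{i=0}^\infty P(s_i,s_{i+1})$ for $\pi=s_0s_1\cdots\in Paths(M)$, and $Po^M(A)=\bigvee\{Po^M(\pi)\mid\pi\in A\}$ for $A\subseteq Paths(M)$. A possibility measure on $\Omega=2^X$ ($X$ a nonempty set) is a map $m:\Omega\to[0,1]$ such that (i) $m(\emptyset)=0$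 and $m(X)=1$; (ii) $A\subseteq B$ implies $m(A)\le m(B)$; (iii) $m(\bigcup_{i\in J}A_i)=\bigvee_{i\in J}m(A_i)$ for every family $(A_i)_{i\in J}$ in $\Omega$. -}

module Defs where

open import Level using (Level; 0ℓ; _⊔_) renaming (suc to lsuc)
open import Data.Bool using (Bool; if_then_else_)
open import Data.Nat using (ℕ; suc)
open import Data.Product using (Σ; ∃; _×_; _,_; proj₁; proj₂)
open import Data.Sum using (_⊎_; inj₁; inj₂)
open import Data.Rational as ℚ using (ℚ; 0ℚ; 1ℚ)
import Data.Rational.Properties as ℚₚ
open import Data.Refinement using (Refinement-syntax; value)
open import Function.Bundles using (_↣_)
open import Relation.Binary.PropositionalEquality using (refl)
open import Relation.Unary using (Pred; _∈_; _∉_; _⊆_; _≐_; ∅; U; ⋃)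

-- A real number is a Dedekind cut, given by its lower class: a nonempty,
-- proper, downward closed set of rationals without a greatest element.
record ℝ : Set₁ where
  field
    lower    : Pred ℚ 0ℓ
    nonempty : ∃ λ p → p ∈ lower
    proper   : ∃ λ p → p ∉ lower
    down     : ∀ {p q} → p ℚ.< q → q ∈ lower → p ∈ lower
    no-max   : ∀ {p} → p ∈ lower → ∃ λ q → p ℚ.< q × q ∈ lower

open ℝ public using (lower)

infix 4 _≤ᴿ_ _≤_ _<_ _≈_

_≤ᴿ_ : ℝ → ℝ → Set
x ≤ᴿ y = lower x ⊆ lower y

fromℚ : ℚ → ℝ
fromℚ r = record
  { lower    = ℚ._< r
  ; nonempty = r ℚ.- 1ℚ , r-1<r
  ; proper   = r , ℚₚ.<-irrefl refl
  ; down     = ℚₚ.<-trans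
  ; no-max   = ℚₚ.<-dense
  }
  where
  r-1<r : r ℚ.- 1ℚ ℚ.< r
  r-1<r = ℚₚ.<-respʳ-≡ (ℚₚ.+-identityʳ r)
            (ℚₚ.+-monoʳ-< r {ℚ.- 1ℚ} {0ℚ} (ℚₚ.negative⁻¹ (ℚ.- 1ℚ)))

record [0,1] : Set₁ where
  constructor mk[0,1]
  field
    real : ℝ
    0≤   : fromℚ 0ℚ ≤ᴿ real
    ≤1   : real ≤ᴿ fromℚ 1ℚ

open [0,1] public using (real)

_≤_ : [0,1] → [0,1] → Set
x ≤ y = real x ≤ᴿ real y

-- Some rational belongs to the lower class of y but not to that of x.
_<_ : [0,1] → [0,1] → Set
x < y = ∃ λ p → p ∈ lower (real y) × p ∉ lower (real x)

-- Equality of real numbers: the lower classes have the same elements.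
_≈_ : [0,1] → [0,1] → Set
x ≈ y = lower (real x) ≐ lower (real y)

0<1ℚ : 0ℚ ℚ.< 1ℚ
0<1ℚ = ℚₚ.positive⁻¹ 1ℚ

𝟎 𝟏 : [0,1]
𝟎 = mk[0,1] (fromℚ 0ℚ) (λ p<0 → p<0) (λ p<0 → ℚₚ.<-trans p<0 0<1ℚ)
𝟏 = mk[0,1] (fromℚ 1ℚ) (λ p<0 → ℚₚ.<-trans p<0 0<1ℚ) (λ p<1 → p<1)

module _ {j : Level} {J : Set j} (f : J → [0,1]) where

  IsSupremum : [0,1] → Set (lsuc 0ℓ ⊔ j)
  IsSupremum x = (∀ i → f i ≤ x) × (∀ y → (∀ i → f i ≤ y) → x ≤ y)

  IsInfimum : [0,1] → Set (lsuc 0ℓ ⊔ j)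
  IsInfimum x = (∀ i → x ≤ f i) × (∀ y → (∀ i → y ≤ f i) → y ≤ x)

-- The supremum and infimum taken in [0,1], so that ⋁ ∅ = 0 and ⋀ ∅ = 1.
-- The lower class of ⋁ f is the union of the lower classes of 0 and the f i;
-- that of ⋀ f is the intersection of the lower classes of 1 and the f i, less
-- its greatest element if there is one.
module _ {J : Set} (f : J → [0,1]) where

  private
    module F (i : J) where
      open [0,1] (f i) public using (0≤; ≤1)
      open ℝ (real (f i)) public using (down; no-max)

    Sup Inf : Pred ℚ 0ℓ
    Sup p = p ℚ.< 0ℚ ⊎ ∃ λ i → p ∈ lower (real (f i))
    Inf p = ∃ λ r → p ℚ.< r × r ℚ.< 1ℚ × (∀ i → r ∈ lower (real (f i)))

    Sup≤1 : ∀ {p} → p ∈ Sup → p ℚ.< 1ℚ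
    Sup≤1 (inj₁ p<0)      = ℚₚ.<-trans p<0 0<1ℚ
    Sup≤1 (inj₂ (i , p∈)) = F.≤1 i p∈

    Sup-down : ∀ {p q} → p ℚ.< q → q ∈ Sup → p ∈ Sup
    Sup-down p<q (inj₁ q<0)      = inj₁ (ℚₚ.<-trans p<q q<0)
    Sup-down p<q (inj₂ (i , q∈)) = inj₂ (i , F.down i p<q q∈)

    Sup-no-max : ∀ {p} → p ∈ Sup → ∃ λ q → p ℚ.< q × q ∈ Sup
    Sup-no-max (inj₁ p<0) with ℚₚ.<-dense p<0
    ... | q , p<q , q<0 = q , p<q , inj₁ q<0
    Sup-no-max (inj₂ (i , p∈)) with F.no-max i p∈
    ... | q , p<q , q∈ = q , p<q , inj₂ (i , q∈)

    0≤Inf : ∀ {p} → p ℚ.< 0ℚ → p ∈ Inf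
    0≤Inf p<0 with ℚₚ.<-dense p<0
    ... | r , p<r , r<0 = r , p<r , ℚₚ.<-trans r<0 0<1ℚ , λ i → F.0≤ i r<0

    Inf≤1 : ∀ {p} → p ∈ Inf → p ℚ.< 1ℚ
    Inf≤1 (r , p<r , r<1 , _) = ℚₚ.<-trans p<r r<1

    Inf-no-max : ∀ {p} → p ∈ Inf → ∃ λ q → p ℚ.< q × q ∈ Inf
    Inf-no-max (r , p<r , r∈) with ℚₚ.<-dense p<r
    ... | q , p<q , q<r = q , p<q , r , q<r , r∈

  ⋁ : [0,1]
  ⋁ = mk[0,1] sup inj₁ Sup≤1
    where
    sup : ℝ
    sup = record
      { lower    = Sup
      ; nonempty = ℚ.- 1ℚ , inj₁ (ℚₚ.negative⁻¹ (ℚ.- 1ℚ))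
      ; proper   = 1ℚ , λ 1∈ → ℚₚ.<-irrefl refl (Sup≤1 1∈)
      ; down     = Sup-down
      ; no-max   = Sup-no-max
      }

  ⋀ : [0,1]
  ⋀ = mk[0,1] inf 0≤Inf Inf≤1
    where
    inf : ℝ
    inf = record
      { lower    = Inf
      ; nonempty = ℚ.- 1ℚ , 0≤Inf (ℚₚ.negative⁻¹ (ℚ.- 1ℚ))
      ; proper   = 1ℚ , λ 1∈ → ℚₚ.<-irrefl refl (Inf≤1 1∈)
      ; down     = λ { p<q (r , q<r , r∈) → r , ℚₚ.<-trans p<q q<r , r∈ }
      ; no-max   = Inf-no-max
      }

  ⋁-isSupremum : IsSupremum f ⋁
  ⋁-isSupremum = (λ i p∈ → inj₂ (i , p∈)) , least
    where
    least : ∀ y → (∀ i → f i ≤ y) → ⋁ ≤ y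
    least y f≤y (inj₁ p<0)      = [0,1].0≤ y p<0
    least y f≤y (inj₂ (i , p∈)) = f≤y i p∈

  ⋀-isInfimum : IsInfimum f ⋀
  ⋀-isInfimum = (λ { i (r , p<r , _ , r∈) → F.down i p<r (r∈ i) }) , greatest
    where
    greatest : ∀ y → (∀ i → y ≤ f i) → y ≤ ⋀
    greatest y y≤f p∈ with ℝ.no-max (real y) p∈
    ... | r , p<r , r∈ = r , p<r , [0,1].≤1 y r∈ , λ i → y≤f i r∈

infixr 6 _∧_

_∧_ : [0,1] → [0,1] → [0,1]
x ∧ y = ⋀ λ (b : Bool) → if b then x else y

record PossibilisticKripkeStructure : Set₁ where
  field
    S         : Set
    countable : S ↣ ℕ
    nonempty  : S
    P         : S → S → [0,1]
    P-normal  : ∀ s → ⋁ (λ s′ → P s s′) ≈ 𝟏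
    I         : S → [0,1]
    I-normal  : ⋁ (λ s → I s) ≈ 𝟏
    AP        : Set
    L         : S → Pred AP 0ℓ

module _ (M : PossibilisticKripkeStructure) where
  open PossibilisticKripkeStructure M

  -- A refinement type: two paths with the same states are equal, so a
  -- predicate on Paths cannot depend on how positivity was proved.
  Paths : Set
  Paths = [ s ∈ (ℕ → S) ∣ (∀ i → 𝟎 < P (s i) (s (suc i))) ]

  Po-path : Paths → [0,1]
  Po-path π = I (s 0) ∧ ⋀ (λ i → P (s i) (s (suc i)))
    where s = value π

  Po : Pred Paths 0ℓ → [0,1]
  Po A = ⋁ λ (π∈A : Σ Paths A) → Po-path (proj₁ π∈A)

-- Families may be indexed by types of any level j (for instance by a collection
-- of subsets of X), whereas ⋃ J A and the supremum are formed in Pred X 0ℓ and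
-- [0,1] only for small J; hence B ≐ ⋃ J A and IsSupremum.
record IsPossibilityMeasure (j : Level) {X : Set} (m : Pred X 0ℓ → [0,1]) : Set (lsuc (0ℓ ⊔ j)) where
  field
    nonempty : X
    m-∅      : m ∅ ≈ 𝟎
    m-X      : m U ≈ 𝟏
    m-mono   : ∀ {A B : Pred X 0ℓ} → A ⊆ B → m A ≤ m B
    m-⋃      : ∀ {J : Set j} (A : J → Pred X 0ℓ) (B : Pred X 0ℓ) →
               B ≐ ⋃ J A → IsSupremum (λ i → m (A i)) (m B)

{-# OPTIONS --safe #-}
module Submission where

open import Defs
open import Level using (Level; 0ℓ)
open import Data.Bool using (true; false; if_then_else_)
open import Data.Empty using (⊥-elim)
open import Data.Irrelevant using ([_])
open import Data.Nat as ℕ using (ℕ; zero; suc)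
import Data.Nat.Properties as ℕₚ
open import Data.Product using (Σ-syntax; ∃; _×_; _,_; proj₁; proj₂)
open import Data.Rational as ℚ using (ℚ; 0ℚ; 1ℚ)
import Data.Rational.Properties as ℚₚ
open import Data.Refinement using (_,_; value)
open import Data.Sum using (inj₁; inj₂)
open import Data.Unit using (⊤)
open import Function.Construct.Identity using (↣-id)
open import Relation.Binary.PropositionalEquality using (refl)
open import Relation.Nullary using (¬_)
open import Relation.Unary using (Pred; _∈_; _⊆_; _≐_; ∅; U; ⋃; ⋂)

-- Po is a supremum of path values over the given set, so monotonicity and
-- preservation of unions are formal.  For Po(Paths) = 1, given 0 ≤ r < 1,
-- normality of I and P supplies an initial state and then, forever, successors
-- whose possibility exceeds r; the resulting path has possibility at least r.
-- Continuity from above fails on the structure with state set ℕ and all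
-- possibilities 1: the sets of paths with initial state ≥ i all have measure 1
-- and decrease to the empty set.

module _ {J : Set} (f : J → [0,1]) (f-normal : ⋁ f ≈ 𝟏) where

  -- The lower class of `⋁ f` is a union, so membership of `r` already names an index, and no choice
  -- principle is needed; `0ℚ ≤ r` rules out the part contributed by 0.
  normal⇒∃-above : ∀ {r} → 0ℚ ℚ.≤ r → r ℚ.< 1ℚ → ∃ λ i → r ∈ lower (real (f i))
  normal⇒∃-above 0≤r r<1 with proj₂ f-normal r<1
  ... | inj₁ r<0  = ⊥-elim (ℚₚ.<-irrefl refl (ℚₚ.≤-<-trans 0≤r r<0))
  ... | inj₂ i,r∈ = i,r∈

fromUnitℚ : ∀ r → 0ℚ ℚ.≤ r → r ℚ.< 1ℚ → [0,1]
fromUnitℚ r 0≤r r<1 = mk[0,1] (fromℚ r) (λ p<0 → ℚₚ.<-≤-trans p<0 0≤r) (λ p<r → ℚₚ.<-trans p<r r<1)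

-- Replaces a possibly negative `p` by a threshold usable for building paths; `p < r` is strict
-- because a value at least `r` need only contain the rationals strictly below `r`.
∃-unitℚ-above : ∀ {p} → p ℚ.< 1ℚ → ∃ λ r → p ℚ.< r × 0ℚ ℚ.≤ r × r ℚ.< 1ℚ
∃-unitℚ-above {p} p<1 with ℚₚ.≤-total 0ℚ p
... | inj₁ 0≤p with ℚₚ.<-dense p<1
...   | r , p<r , r<1 = r , p<r , ℚₚ.≤-trans 0≤p (ℚₚ.<⇒≤ p<r) , r<1
∃-unitℚ-above p<1 | inj₂ p≤0 with ℚₚ.<-dense 0<1ℚ
...   | r , 0<r , r<1 = r , ℚₚ.≤-<-trans p≤0 0<r , ℚₚ.<⇒≤ 0<r , r<1

∧-greatest : ∀ x y z → x ≤ y → x ≤ z → x ≤ (y ∧ z)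
∧-greatest x y z x≤y x≤z = proj₂ (⋀-isInfimum λ b → if b then y else z) x λ { true → x≤y ; false → x≤z }

module _ (M : PossibilisticKripkeStructure) where
  open PossibilisticKripkeStructure M

  Po-path-greatest : ∀ x (π : Paths M) → let s = value π in
    x ≤ I (s 0) → (∀ i → x ≤ P (s i) (s (suc i))) → x ≤ Po-path M π
  Po-path-greatest x π x≤I x≤P =
    ∧-greatest x (I (value π 0)) (⋀ P-step) x≤I (proj₂ (⋀-isInfimum P-step) x x≤P)
    where
    P-step : ℕ → [0,1]
    P-step i = P (value π i) (value π (suc i))

  module PathAbove {r : ℚ} (0≤r : 0ℚ ℚ.≤ r) (r<1 : r ℚ.< 1ℚ) where

    initial : ∃ λ s → r ∈ lower (real (I s))
    initial = normal⇒∃-above I I-normal 0≤r r<1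

    successor : ∀ s → ∃ λ s′ → r ∈ lower (real (P s s′))
    successor s = normal⇒∃-above (P s) (P-normal s) 0≤r r<1

    states : ℕ → S
    states zero    = proj₁ initial
    states (suc i) = proj₁ (successor (states i))

    path : Paths M
    -- The rational `r` itself separates 0 from each transition value, even when `r` is 0.
    path = states , [ (λ i → r , proj₂ (successor (states i)) , λ r<0 → ℚₚ.<-irrefl refl (ℚₚ.≤-<-trans 0≤r r<0)) ]

    -- Each transition value exceeds `r`, but an infimum of infinitely many of them may drop to `r`,
    -- so the bound is not strict.
    r≤Po-path : fromUnitℚ r 0≤r r<1 ≤ Po-path M path
    r≤Po-path = Po-path-greatest (fromUnitℚ r 0≤r r<1) path
      (λ p<r → ℝ.down (real (I (states 0))) p<r (proj₂ initial))
      (λ i p<r → ℝ.down (real (P (states i) (states (suc i)))) p<r (proj₂ (successor (states i))))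

  Po-mono : ∀ {A B : Pred (Paths M) 0ℓ} → A ⊆ B → Po M A ≤ Po M B
  Po-mono A⊆B (inj₁ p<0)              = inj₁ p<0
  Po-mono A⊆B (inj₂ ((π , π∈A) , p∈)) = inj₂ ((π , A⊆B π∈A) , p∈)

  -- Assuming only `A ⊆ ∅` covers both `∅` itself and the empty intersection in the counterexample.
  Po-empty : ∀ {A : Pred (Paths M) 0ℓ} → A ⊆ ∅ → Po M A ≤ 𝟎
  Po-empty A⊆∅ (inj₁ p<0)             = p<0
  Po-empty A⊆∅ (inj₂ ((π , π∈A) , _)) = ⊥-elim (A⊆∅ π∈A)

  𝟏≤Po-U : 𝟏 ≤ Po M U
  𝟏≤Po-U p<1 with ∃-unitℚ-above p<1
  ... | r , p<r , 0≤r , r<1 = inj₂ ((path , _) , r≤Po-path p<r)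
    where open PathAbove 0≤r r<1

  Po-⋃ : ∀ {j} {J : Set j} (A : J → Pred (Paths M) 0ℓ) (B : Pred (Paths M) 0ℓ) →
         B ≐ ⋃ J A → IsSupremum (λ i → Po M (A i)) (Po M B)
  Po-⋃ A B (B⊆⋃A , ⋃A⊆B) = (λ i → Po-mono {A i} {B} λ π∈Ai → ⋃A⊆B (i , π∈Ai)) , least
    where
    least : ∀ y → (∀ i → Po M (A i) ≤ y) → Po M B ≤ y
    least y A≤y (inj₁ p<0)              = [0,1].0≤ y p<0
    least y A≤y (inj₂ ((π , π∈B) , p∈)) with B⊆⋃A π∈B
    ... | i , π∈Ai = A≤y i (inj₂ ((π , π∈Ai) , p∈))

  Po-isPossibilityMeasure : ∀ j → IsPossibilityMeasure j (Po M)
  Po-isPossibilityMeasure j = record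
    { nonempty = PathAbove.path ℚₚ.≤-refl 0<1ℚ
    ; m-∅      = Po-empty {∅} (λ ()) , [0,1].0≤ (Po M ∅)
    ; m-X      = [0,1].≤1 (Po M U) , 𝟏≤Po-U
    ; m-mono   = λ {A} {B} → Po-mono {A} {B}
    ; m-⋃      = Po-⋃
    }

⋁-const-𝟏 : ∀ {J : Set} → J → ⋁ (λ (_ : J) → 𝟏) ≈ 𝟏
⋁-const-𝟏 {J} i = [0,1].≤1 (⋁ λ (_ : J) → 𝟏) , λ p<1 → inj₂ (i , p<1)

fullℕ : PossibilisticKripkeStructure
fullℕ = record
  { S         = ℕ
  ; countable = ↣-id ℕ
  ; nonempty  = 0
  ; P         = λ _ _ → 𝟏
  ; P-normal  = λ _ → ⋁-const-𝟏 0
  ; I         = λ _ → 𝟏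
  ; I-normal  = ⋁-const-𝟏 0
  ; AP        = ⊤
  ; L         = λ _ → ∅
  }

StartsAbove : ℕ → Pred (Paths fullℕ) 0ℓ
StartsAbove i π = i ℕ.≤ value π 0

constant : ℕ → Paths fullℕ
constant i = (λ _ → i) , [ (λ _ → 0ℚ , 0<1ℚ , ℚₚ.<-irrefl refl) ]

𝟏≤Po-StartsAbove : ∀ i → 𝟏 ≤ Po fullℕ (StartsAbove i)
𝟏≤Po-StartsAbove i p<1 =
  inj₂ ((constant i , ℕₚ.≤-refl) , Po-path-greatest fullℕ 𝟏 (constant i) (λ q<1 → q<1) (λ _ q<1 → q<1) p<1)

⋂-StartsAbove-empty : ⋂ ℕ StartsAbove ⊆ ∅
-- A path leaves the chain at the index one past its initial state.
⋂-StartsAbove-empty {π} π∈ = ℕₚ.1+n≰n (π∈ (suc (value π 0)))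

StartsAbove-discontinuous :
  ¬ (Po fullℕ (⋂ ℕ StartsAbove) ≈ ⋀ (λ i → Po fullℕ (StartsAbove i)))
StartsAbove-discontinuous (_ , ⋀≤Po⋂) = ℚₚ.<-irrefl refl 0<0
  where
  0<0 : 0ℚ ℚ.< 0ℚ
  -- The chain 1 ≤ infimum ≤ `Po` of the intersection ≤ 0, evaluated at the rational 0.
  0<0 = Po-empty fullℕ {⋂ ℕ StartsAbove} (λ {π} → ⋂-StartsAbove-empty {π})
          (⋀≤Po⋂ (proj₂ (⋀-isInfimum λ i → Po fullℕ (StartsAbove i)) 𝟏 𝟏≤Po-StartsAbove 0<1ℚ))

theorem8 : (j : Level) →
    ((M : PossibilisticKripkeStructure) → IsPossibilityMeasure j (Po M))
    × (Σ[ M ∈ PossibilisticKripkeStructure ] Σ[ A ∈ (ℕ → Pred (Paths M) 0ℓ) ]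
    ((∀ i → A (suc i) ⊆ A i)
    × ¬ (Po M (⋂ ℕ A) ≈ ⋀ (λ i → Po M (A i)))))
theorem8 j =
  (λ M → Po-isPossibilityMeasure M j) ,
  -- The chain decreases because `suc i ≤ n` is by definition `i < n`.
  fullℕ , StartsAbove , (λ _ → ℕₚ.<⇒≤) , StartsAbove-discontinuous
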